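{- In the $2$-pass streaming model with a single output pass, Sliding-Min can be solved in $O\big(\sqrt{NR/K}\,(\log R+\log N)\big)$ bits of space, where $N$ is the length of the input, $K$ is the window size, and $R$ is the upper bound on the input values (with an absolute implied constant).
   Context: Problem. The input is an array $A_0,\dots,A_{N-1}$ of integers in $[0,R]$ together with a window size $K\le N$. Sliding-Min asks for the minimum of $A_i,\dots,A_{i+K-1}$ for every $i\in\{0,\dots,N-K\}$. $p$-pass streaming model (here $p=2$). The algorithm knows $N,K,R$ in advance. The input is accessed only through $p$ sequential left-to-right scans (input passes). The $N-K+1$ answers are written to a write-only output stream, each exactly once. A single output pass means that, over the whole execution, the answers are written in the order of increasing window index $i=0,1,\dots,N-K$. Output need not be synchronized with the input position: at any time the algorithm may write any number of answers. Space is the maximum number of bits of working memory held at any time; input and output streams are not counted. -}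

module Defs where

open import Data.Bool.Base using (Bool)
open import Data.Fin.Base as Fin using (Fin; toℕ)
open import Data.List.Base using (List; []; _∷_; _++_; allFin; upTo)
open import Data.List.Relation.Binary.Pointwise using (Pointwise)
open import Data.Nat.Base using (ℕ; suc; _+_; _*_; _∸_; _^_; _≤_; _<_)
open import Data.Nat.Logarithm using (⌊log₂_⌋)
open import Data.Product.Base using (_×_; _,_; ∃-syntax)
open import Data.Vec.Base using (Vec; lookup; toList)
open import Relation.Binary.PropositionalEquality.Core using (_≡_)

-- The integers in [0,R].
Value : ℕ → Set
Value R = Fin (suc R)

Memory : ℕ → Set
Memory s = Vec Bool s

-- A deterministic p-pass streaming algorithm over [0,R] with s bits of working
-- memory.  The s bits are all that survives from one input item to the next:
-- the transitions see the number of the current pass but not the position in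
-- the input, so a position counter has to be kept in memory.  Every transition
-- may append any number of answers to the output stream.  The parameters N and
-- K are known in advance because an algorithm is chosen for each N, K, R.
record Algorithm (p R s : ℕ) : Set where
  field
    start  : Memory s
    onItem : Fin p → Memory s → Value R → List (Value R) × Memory s
    onEnd  : Fin p → Memory s → List (Value R) × Memory s

module _ {p R s : ℕ} (alg : Algorithm p R s) where
  open Algorithm alg

  runPass : Fin p → Memory s → List (Value R) → List (Value R) × Memory s
  runPass q m []       = onEnd q m
  runPass q m (x ∷ xs) =
    let out  , m′  = onItem q m x
        out′ , m″ = runPass q m′ xs
    in  out ++ out′ , m″

  runPasses : List (Fin p) → Memory s → List (Value R) → List (Value R)
  runPasses []       m xs = []
  runPasses (q ∷ qs) m xs =
    let out , m′ = runPass q m xs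
    in  out ++ runPasses qs m′ xs

  output : List (Value R) → List (Value R)
  output = runPasses (allFin p) start

InWindow : {N : ℕ} → ℕ → ℕ → Fin N → Set
InWindow K i j = i ≤ toℕ j × toℕ j < i + K

IsWindowMin : {N R : ℕ} → ℕ → Vec (Value R) N → ℕ → Value R → Set
IsWindowMin K A i v =
  (∃[ j ] (InWindow K i j × lookup A j ≡ v)) ×
  (∀ j → InWindow K i j → v Fin.≤ lookup A j)

-- A single output pass: the whole output stream consists of the answers for the
-- windows 0, 1, …, N-K, in this order and each exactly once.
SolvesSlidingMin : {p R s : ℕ} → (N K : ℕ) → Algorithm p R s → Set
SolvesSlidingMin {R = R} N K alg =
  (A : Vec (Value R) N) →
  Pointwise (IsWindowMin K A) (upTo (suc (N ∸ K))) (output alg (toList A))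

-- s ≤ C √(N R / K) (log R + log N) with the division and the square root
-- cleared (for K > 0).  For x ≥ 1, ⌊log₂ x⌋ ≤ log₂ x ≤ 2 ⌊log₂ x⌋, so rounding
-- the logarithms affects only the constant C.  For R = 0 the bound is s = 0.
SpaceBound : (C N K R s : ℕ) → Set
SpaceBound C N K R s =
  K * s ^ 2 ≤ N * R * (C * (⌊log₂ R ⌋ + ⌊log₂ N ⌋)) ^ 2

{-# OPTIONS --safe #-}

-- Cut the values into buckets of size B ≈ √(NR/K) and the positions into N/K
-- blocks of length K.  The first pass keeps, for each block and each bucket j
-- below the top one, the first and the last position of the block whose value
-- lies in a bucket ≤ j: these are O((N/K)(R/B)) = O(√(NR/K)) words.  A window of
-- length K that meets a block contains one of its ends, so this table determines
-- the bucket β i of the minimum of every window i.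
--
-- In the second pass window i is answered as soon as its last item has been read
-- or some window i′ > i with β i′ > β i has been reached: the part of window i
-- lying in window i′ cannot contain the minimum.  While window e is the first
-- unanswered one, no window starting in the part read so far has a bucket larger
-- than β e, so only values of the single bucket β e can still become answers,
-- and the last position of each of its B values is all that has to be stored.
module Submission where

open import Data.Bool.Base using (if_then_else_)
open import Data.Fin.Base as Fin using (Fin; zero; suc; toℕ; fromℕ<; combine; remQuot)
open import Data.Fin.Properties as Fin
  using (any?; 2↔Bool; combine-remQuot; toℕ<n; toℕ≤pred[n]; toℕ-fromℕ<; toℕ-injective)
open import Data.List.Base as List using (List; []; _∷_; _++_; [_]; upTo)
open import Data.List.Properties using (++-identityʳ; ++-assoc; upTo-∷ʳ)
open import Data.List.Relation.Binary.Pointwise using (Pointwise; []; _∷_; ++⁺)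
open import Data.Nat.Base
open import Data.Nat.DivMod
open import Data.Nat.Logarithm using (⌊log₂_⌋; ⌊log₂⌋-mono-≤; ⌊log₂[2^n]⌋≡n)
open import Data.Nat.Properties
open import Data.Nat.Tactic.RingSolver using (solve-∀)
open import Data.Product.Base using (_×_; _,_; proj₁; proj₂; ∃-syntax; Σ-syntax; map₁)
open import Data.Sum.Base using (_⊎_; inj₁; inj₂)
open import Data.Vec.Base as Vec using (Vec; []; _∷_; lookup; tabulate; replicate; toList)
open import Data.Vec.Properties using (lookup∘tabulate; lookup-replicate)
open import Defs
open import Function.Base using (_∘_)
open import Function.Bundles using (Inverse)
open import Relation.Binary.PropositionalEquality hiding (J; [_])
open import Relation.Nullary using (¬_; Dec; yes; no; does; contradiction; _×-dec_; _⊎-dec_)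
open import Relation.Unary using (Decidable)

-- Least index satisfying a decidable predicate

if-elim : ∀ {A P : Set} {a b : A} (Q : A → Set) (P? : Dec P) →
          (P → Q a) → (¬ P → Q b) → Q (if does P? then a else b)
if-elim Q (yes p) f g = f p
if-elim Q (no ¬p) f g = g ¬p

-- Without a witness the value is `m`, hence a natural number and not an element of `Fin m`.
least : ∀ {m} {P : Fin m → Set} → Decidable P → ℕ
least {zero}  P? = 0
least {suc m} P? = if does (P? zero) then 0 else suc (least (P? ∘ suc))

least-bound : ∀ {m} {P : Fin m → Set} (P? : Decidable P) → least P? ≤ m
least-bound {zero}  P? = z≤n
least-bound {suc m} P? =
  if-elim (_≤ suc m) (P? zero) (λ _ → z≤n) (λ _ → s≤s (least-bound (P? ∘ suc)))

least-≤ : ∀ {m} {P : Fin m → Set} (P? : Decidable P) {j} → P j → least P? ≤ toℕ j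
least-≤ P? {zero}  p =
  if-elim (_≤ 0) (P? zero) (λ _ → z≤n) (λ ¬p → contradiction p ¬p)
least-≤ P? {suc j} p =
  if-elim (_≤ suc (toℕ j)) (P? zero) (λ _ → z≤n) (λ _ → s≤s (least-≤ (P? ∘ suc) p))

least-attained : ∀ {m} {P : Fin m → Set} (P? : Decidable P) → least P? < m →
                 ∃[ j ] toℕ j ≡ least P? × P j
least-attained {zero}  {P} P? ()
least-attained {suc m} {P} P? =
  if-elim (λ l → l < suc m → ∃[ j ] toℕ j ≡ l × P j) (P? zero)
    (λ p _ → zero , refl , p)
    (λ _ l<m → let j , j≡ , p = least-attained (P? ∘ suc) (s≤s⁻¹ l<m) in suc j , cong suc j≡ , p)

toℕ-mod : ∀ {k m} .{{_ : NonZero m}} → k < m → toℕ (k mod m) ≡ k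
toℕ-mod {k} {m} k<m = trans (toℕ-fromℕ< (m%n<n k m)) (m<n⇒m%n≡m k<m)

-- The witness `u` keeps the least index below `suc m`, so the reduction only changes the type and
-- never wraps around.
least-mod : ∀ {m} {P : Fin (suc m) → Set} (P? : Decidable P) {u} → P u →
            P (least P? mod suc m) × least P? mod suc m Fin.≤ u
least-mod {m} {P} P? {u} p =
  subst P (toℕ-injective (trans v≡ (sym l≡))) pv , subst (_≤ toℕ u) (sym l≡) l≤u
  where
  l≤u : least P? ≤ toℕ u
  l≤u = least-≤ P? p
  l<m : least P? < suc m
  l<m = ≤-<-trans l≤u (toℕ<n u)
  l≡ : toℕ (least P? mod suc m) ≡ least P?
  l≡ = toℕ-mod l<m
  v≡ = proj₁ (proj₂ (least-attained P? l<m))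
  pv = proj₂ (proj₂ (least-attained P? l<m))

-- Encoding states in bits

record Code (S : Set) (s : ℕ) : Set where
  field
    encode        : S → Memory s
    decode        : Memory s → S
    decode∘encode : ∀ σ → decode (encode σ) ≡ σ

open Code

take-++ : ∀ {A : Set} {m n} (xs : Vec A m) (ys : Vec A n) → Vec.take m (xs Vec.++ ys) ≡ xs
take-++ []       ys = refl
take-++ (x ∷ xs) ys = cong (x ∷_) (take-++ xs ys)

drop-++ : ∀ {A : Set} {m n} (xs : Vec A m) (ys : Vec A n) → Vec.drop m (xs Vec.++ ys) ≡ ys
drop-++ []       ys = refl
drop-++ (x ∷ xs) ys = drop-++ xs ys

bitsᶜ : ∀ w → Code (Fin (2 ^ w)) w
bitsᶜ zero = record
  { encode        = λ _ → []
  ; decode        = λ _ → zero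
  ; decode∘encode = λ { zero → refl }
  }
bitsᶜ (suc w) = record
  { encode        = λ i → let b , j = remQuot {2} (2 ^ w) i
                          in Inverse.to 2↔Bool b ∷ encode (bitsᶜ w) j
  ; decode        = λ { (b ∷ m) → combine (Inverse.from 2↔Bool b) (decode (bitsᶜ w) m) }
  ; decode∘encode = λ i → let b , j = remQuot {2} (2 ^ w) i in trans
      (cong₂ combine (Inverse.strictlyInverseʳ 2↔Bool b) (decode∘encode (bitsᶜ w) j))
      (combine-remQuot {2} (2 ^ w) i)
  }

_×ᶜ_ : ∀ {S T s t} → Code S s → Code T t → Code (S × T) (s + t)
_×ᶜ_ {s = s} c d = record
  { encode        = λ (σ , τ) → encode c σ Vec.++ encode d τ
  ; decode        = λ m → decode c (Vec.take s m) , decode d (Vec.drop s m)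
  ; decode∘encode = λ (σ , τ) → cong₂ _,_
      (trans (cong (decode c) (take-++ (encode c σ) (encode d τ))) (decode∘encode c σ))
      (trans (cong (decode d) (drop-++ (encode c σ) (encode d τ))) (decode∘encode d τ))
  }

vecᶜ : ∀ {S s} → Code S s → ∀ n → Code (Vec S n) (n * s)
vecᶜ c zero = record
  { encode        = λ _ → []
  ; decode        = λ _ → []
  ; decode∘encode = λ { [] → refl }
  }
vecᶜ c (suc n) = record
  { encode        = λ { (σ ∷ σs) → encode d (σ , σs) }
  ; decode        = λ m → let σ , σs = decode d m in σ ∷ σs
  ; decode∘encode = λ { (σ ∷ σs) → cong (λ (σ , σs) → σ ∷ σs) (decode∘encode d (σ , σs)) }
  }
  where d = c ×ᶜ vecᶜ c n

infixr 2 _×ᶜ_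

-- Windows and invariants of runs

windows≤N : ∀ {N K} → 1 ≤ K → K ≤ N → suc (N ∸ K) ≤ N
windows≤N = ∸-monoʳ-<

window-inhabited : ∀ {N K i} → 1 ≤ K → K ≤ N → i < suc (N ∸ K) → ∃[ y ] InWindow {N} K i y
window-inhabited {N} {K} {i} 1≤K K≤N i<M =
  fromℕ< i<N , ≤-reflexive (sym y≡i) , subst (_< i + K) (sym y≡i) (m<m+n i 1≤K)
  where
  i<N = <-≤-trans i<M (windows≤N 1≤K K≤N)
  y≡i = toℕ-fromℕ< i<N

-- Induction on the input with `P` shifted by one. The list `os` holds what was written earlier, so
-- `P` speaks of the whole output stream.
runPass-invariant :
  ∀ {p R s} (alg : Algorithm p R s) (q : Fin p) → let open Algorithm alg in
  ∀ {N} (A : Vec (Value R) N) (P : ℕ → Memory s → List (Value R) → Set) {m os} →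
  P 0 m os →
  (∀ i {m os} → P (toℕ i) m os →
    let out , m′ = onItem q m (lookup A i) in P (suc (toℕ i)) m′ (os ++ out)) →
  ∃[ m′ ] ∃[ out ] P N m′ (os ++ out) ×
    runPass alg q m (toList A) ≡ (out ++ proj₁ (onEnd q m′) , proj₂ (onEnd q m′))
runPass-invariant alg q [] P {m} {os} P₀ step =
  m , [] , subst (P 0 m) (sym (++-identityʳ os)) P₀ , refl
runPass-invariant alg q (v ∷ A) P {m} {os} P₀ step
  with m′ , out , Pₙ , eq ← runPass-invariant alg q A (P ∘ suc) (step zero P₀) (step ∘ suc) =
  m′ , o ++ out , subst (P _ m′) (++-assoc os o out) Pₙ ,
  trans (cong (λ (out , m) → o ++ out , m) eq) (cong (_, _) (sym (++-assoc o out _)))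
  where o = proj₁ (Algorithm.onItem alg q m v)

twoPass-invariant :
  ∀ {R s} (alg : Algorithm 2 R s) → let open Algorithm alg in
  ∀ {N} (A : Vec (Value R) N) (P₀ P₁ : ℕ → Memory s → List (Value R) → Set) →
  P₀ 0 start [] →
  (∀ i {m os} → P₀ (toℕ i) m os →
    let out , m′ = onItem zero m (lookup A i) in P₀ (suc (toℕ i)) m′ (os ++ out)) →
  (∀ {m os} → P₀ N m os → let out , m′ = onEnd zero m in P₁ 0 m′ (os ++ out)) →
  (∀ i {m os} → P₁ (toℕ i) m os →
    let out , m′ = onItem (suc zero) m (lookup A i) in P₁ (suc (toℕ i)) m′ (os ++ out)) →
  ∃[ m ] ∃[ os ] P₁ N m os × output alg (toList A) ≡ os ++ proj₁ (onEnd (suc zero) m)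
twoPass-invariant alg A P₀ P₁ start₀ step₀ turn step₁
  with m₁ , out₁ , p₁ , eq₁ ← runPass-invariant alg zero A P₀ {os = []} start₀ step₀
  with m₂ , out₂ , p₂ , eq₂ ← runPass-invariant alg (suc zero) A P₁ (turn p₁) step₁
  rewrite eq₁ | eq₂ =
  m₂ , _ , p₂ ,
  trans (cong (os₁ ++_) (++-identityʳ _)) (sym (++-assoc os₁ out₂ _))
  where os₁ = out₁ ++ proj₁ (Algorithm.onEnd alg zero m₁)

-- The two-pass algorithm

module TwoPass (N K R B w : ℕ) .{{_ : NonZero K}} .{{_ : NonZero B}} where

  -- `J` is the index of the top bucket, `n` is enough blocks to cover all positions, and `M` counts
  -- the windows.
  J n M : ℕ
  J = R / B
  n = suc (N / K)
  M = suc (N ∸ K)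

  -- A word holds a counter or the stamp of a position y, which is y + 1 if there
  -- is such a position and 0 otherwise.  A state consists of the number of items
  -- read, the next window to be answered, the table and, for each offset within
  -- the current bucket, the stamp of the last position of that value.
  Word Cell Table Slots State : Set
  Word  = Fin (2 ^ w)
  Cell  = Word × Word
  Table = Vec (Vec Cell n) J
  Slots = Vec Word B
  State = Word × Word × Table × Slots

  -- In a run on `N < 2 ^ w` items every stored number is at most `N`, so the reduction changes none
  -- of them.
  word : ℕ → Word
  word k = (k mod (2 ^ w)) {{m^n≢0 2 w}}

  stateᶜ : Code State (w + (w + (J * (n * (w + w)) + B * w)))
  stateᶜ = bitsᶜ w ×ᶜ bitsᶜ w ×ᶜ vecᶜ (vecᶜ (bitsᶜ w ×ᶜ bitsᶜ w) n) J ×ᶜ vecᶜ (bitsᶜ w) B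

  bucket : Value R → ℕ
  bucket v = toℕ v / B

  offset : Value R → Fin B
  offset v = toℕ v mod B

  Marks : ℕ → Value R → Fin J → Fin n → Set
  Marks x v j b = x / K ≡ toℕ b × bucket v ≤ toℕ j

  marks? : ∀ x v j b → Dec (Marks x v j b)
  marks? x v j b = (x / K ≟ toℕ b) ×-dec (bucket v ≤? toℕ j)

  extend : ℕ → Cell → Cell
  extend x (f , l) = (if does (toℕ f ≟ 0) then word (suc x) else f) , word (suc x)

  cell : Table → Fin J → Fin n → Cell
  cell T j b = lookup (lookup T j) b

  mark : ℕ → Value R → Table → Table
  mark x v T = tabulate λ j → tabulate λ b →
    if does (marks? x v j b) then extend x (cell T j b) else cell T j b

  -- Window i contains the position with stamp t.
  Within : ℕ → ℕ → Set
  Within i t = i < t × t ≤ i + K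

  within? : ∀ i t → Dec (Within i t)
  within? i t = (i <? t) ×-dec (t ≤? i + K)

  -- The stamp 0 lies within no window, so cells without a marked position never produce a hit.
  Hit : Table → ℕ → Fin J → Set
  Hit T i j = ∃[ b ] (Within i (toℕ (proj₁ (cell T j b))) ⊎ Within i (toℕ (proj₂ (cell T j b))))

  hit? : ∀ T i → Decidable (Hit T i)
  hit? T i j = any? λ b → within? i _ ⊎-dec within? i _

  opaque
    -- The value J, taken if there is no hit, is the top bucket.
    β : Table → ℕ → ℕ
    β T i = least (hit? T i)

    β-bound : ∀ T i → β T i ≤ J
    β-bound T i = least-bound (hit? T i)

    β-≤ : ∀ T i {j} → Hit T i j → β T i ≤ toℕ j
    β-≤ T i = least-≤ (hit? T i)

    β-attained : ∀ T i → β T i < J → ∃[ j ] (toℕ j ≡ β T i × Hit T i j)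
    β-attained T i = least-attained (hit? T i)

  -- Here `x` counts the items read: `i′ ≤ x` says that everything before window `i′` has been seen.
  Ready : Table → ℕ → ℕ → Set
  Ready T x i = i + K ≤ x ⊎ ∃[ i′ ] (i′ < M × (i < i′ × i′ ≤ x × β T i < β T i′))

  ready? : ∀ T x i → Dec (Ready T x i)
  ready? T x i = (i + K ≤? x) ⊎-dec
    anyUpTo? (λ i′ → (i <? i′) ×-dec (i′ ≤? x) ×-dec (β T i <? β T i′)) M

  -- The slots for the bucket of window i after reading item v at position x, from
  -- the slots for the bucket of window e.
  refresh : Table → ℕ → Value R → ℕ → Slots → ℕ → Slots
  refresh T x v e ts i = tabulate λ r →
    if does ((bucket v ≟ β T i) ×-dec (r Fin.≟ offset v)) then word (suc x) else
    if does (β T i ≟ β T e) then lookup ts r else word 0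

  -- A stamp above `i` belongs to a position at or after `i`; this test discards values whose last
  -- occurrence has left the window.
  Candidate : Table → Slots → ℕ → Value R → Set
  Candidate T ts i v = bucket v ≡ β T i × i < toℕ (lookup ts (offset v))

  candidate? : ∀ T ts i → Decidable (Candidate T ts i)
  candidate? T ts i v = (bucket v ≟ β T i) ×-dec (i <? toℕ (lookup ts (offset v)))

  opaque
    answer : Table → Slots → ℕ → Value R
    answer T ts i = least (candidate? T ts i) mod suc R

    answer-least : ∀ T ts i {u} → Candidate T ts i u →
                   Candidate T ts i (answer T ts i) × answer T ts i Fin.≤ u
    answer-least T ts i = least-mod (candidate? T ts i)

  -- The fuel is the number of unanswered windows. Stopping at the first window that is not ready
  -- keeps the answers in order; the slots depend on the window because its bucket may differ from
  -- that of its predecessor.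
  emit : Table → ℕ → (ℕ → Slots) → ℕ → ℕ → List (Value R) × ℕ
  emit T x ts zero    i = [] , i
  emit T x ts (suc k) i = if does (ready? T x i)
    then map₁ (answer T (ts i) i ∷_) (emit T x ts k (suc i))
    else ([] , i)

  scan : State → Value R → State
  scan (x , e , T , ts) v = word (suc (toℕ x)) , e , mark (toℕ x) v T , ts

  rewind : Table → State
  rewind T = word 0 , word 0 , T , replicate B (word 0)

  reply : State → Value R → List (Value R) × State
  reply (x , e , T , ts) v =
    let ts′      = refresh T (toℕ x) v (toℕ e) ts
        out , e′ = emit T (suc (toℕ x)) ts′ (M ∸ toℕ e) (toℕ e)
    in out , word (suc (toℕ x)) , word e′ , T , ts′ e′

  algorithm : Algorithm 2 R _
  algorithm = record
    { start  = encode stateᶜ (rewind (replicate J (replicate n (word 0 , word 0))))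
    ; onItem = λ
      { zero    m v → [] , encode stateᶜ (scan (decode stateᶜ m) v)
      ; (suc _) m v → let out , σ = reply (decode stateᶜ m) v in out , encode stateᶜ σ
      }
    ; onEnd  = λ
      { zero    m → let _ , _ , T , _ = decode stateᶜ m in [] , encode stateᶜ (rewind T)
      ; (suc _) m → [] , m
      }
    }

  -- Correctness: the table built by the first pass

  module Correctness (N<2^w : N < 2 ^ w) (K≤N : K ≤ N) (A : Vec (Value R) N) where

    toℕ-word : ∀ {k} → k ≤ N → toℕ (word k) ≡ k
    toℕ-word k≤N = toℕ-mod {{m^n≢0 2 w}} (≤-<-trans k≤N N<2^w)

    window-end : ∀ {i} → i < M → i + K ≤ N
    window-end {i} (s≤s i≤N∸K) = m≤o∸n⇒m+n≤o i K≤N i≤N∸K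

    bkt : Fin N → ℕ
    bkt y = bucket (lookup A y)

    -- Nonzero stamps are genuine positions satisfying `Q`, and they bracket all such positions
    -- among the first `x`. The bound in `first` places a recorded first position before the next
    -- item.
    record Extent (Q : Fin N → Set) (x : ℕ) (c : Cell) : Set where
      field
        first  : 0 < toℕ (proj₁ c) → ∃[ y ] (suc (toℕ y) ≡ toℕ (proj₁ c) × toℕ y < x × Q y)
        last   : 0 < toℕ (proj₂ c) → ∃[ y ] (suc (toℕ y) ≡ toℕ (proj₂ c) × Q y)
        covers : ∀ y → toℕ y < x → Q y →
                 0 < toℕ (proj₁ c) × toℕ (proj₁ c) ≤ suc (toℕ y) × suc (toℕ y) ≤ toℕ (proj₂ c)

    open Extent

    extent-empty : ∀ {Q c} → toℕ (proj₁ c) ≡ 0 → toℕ (proj₂ c) ≡ 0 → Extent Q 0 c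
    extent-empty f≡0 l≡0 = record
      { first  = λ 0<f → contradiction (subst (0 <_) f≡0 0<f) λ ()
      ; last   = λ 0<l → contradiction (subst (0 <_) l≡0 0<l) λ ()
      ; covers = λ y ()
      }

    extent-skip : ∀ {Q c} (i : Fin N) → ¬ Q i → Extent Q (toℕ i) c → Extent Q (suc (toℕ i)) c
    extent-skip {Q} i ¬q E = record
      { first  = λ 0<f → let y , y≡ , y< , q = first E 0<f in y , y≡ , m<n⇒m<1+n y< , q
      ; last   = last E
      ; covers = λ y y≤ q → covers E y
          (≤∧≢⇒< (s≤s⁻¹ y≤) (λ y≡i → ¬q (subst Q (toℕ-injective y≡i) q))) q
      }

    extent-extend : ∀ {Q c} (i : Fin N) → Q i → Extent Q (toℕ i) c →
                    Extent Q (suc (toℕ i)) (extend (toℕ i) c)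
    extent-extend {Q} {f , l} i q E = record
      { first  = λ 0<f′ → first′ 0<f′
      ; last   = λ _ → i , sym i+1≡ , q
      ; covers = λ y y≤ q′ → let 0<f′ , f′≤ = covers′ y y≤ q′ in
          0<f′ , f′≤ , subst (suc (toℕ y) ≤_) (sym i+1≡) y≤
      }
      where
      i+1≡ : toℕ (word (suc (toℕ i))) ≡ suc (toℕ i)
      i+1≡ = toℕ-word (toℕ<n i)

      f′ = proj₁ (extend (toℕ i) (f , l))

      first′ : 0 < toℕ f′ → ∃[ y ] (suc (toℕ y) ≡ toℕ f′ × toℕ y < suc (toℕ i) × Q y)
      first′ = if-elim
        (λ g → 0 < toℕ g → ∃[ y ] (suc (toℕ y) ≡ toℕ g × toℕ y < suc (toℕ i) × Q y)) (toℕ f ≟ 0)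
        (λ _ _ → i , sym i+1≡ , ≤-refl , q)
        (λ _ 0<f → let y , y≡ , y< , q = first E 0<f in y , y≡ , m<n⇒m<1+n y< , q)

      covers′ : ∀ y → toℕ y < suc (toℕ i) → Q y → 0 < toℕ f′ × toℕ f′ ≤ suc (toℕ y)
      covers′ y y≤ q′ = if-elim (λ g → 0 < toℕ g × toℕ g ≤ suc (toℕ y)) (toℕ f ≟ 0) fresh kept
        where
        fresh : toℕ f ≡ 0 → _
        fresh f≡0 with m≤n⇒m<n∨m≡n (s≤s⁻¹ y≤)
        -- An earlier position satisfying `Q` would have made the first stamp positive.
        ... | inj₁ y<i = contradiction f≡0 (≢-sym (<⇒≢ (proj₁ (covers E y y<i q′))))
        ... | inj₂ y≡i = subst (0 <_) (sym i+1≡) z<s ,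
                         ≤-reflexive (trans i+1≡ (cong suc (sym y≡i)))
        kept : ¬ toℕ f ≡ 0 → _
        kept f≢0 with m≤n⇒m<n∨m≡n (s≤s⁻¹ y≤)
        ... | inj₁ y<i = let 0<f , f≤ , _ = covers E y y<i q′ in 0<f , f≤
        ... | inj₂ y≡i = let 0<f = n≢0⇒n>0 f≢0 ; _ , z≡ , z<i , _ = first E 0<f in
          0<f , subst₂ _≤_ z≡ (cong suc (sym y≡i)) (m≤n⇒m≤1+n z<i)

    MarkedIn : Fin J → Fin n → Fin N → Set
    MarkedIn j b y = Marks (toℕ y) (lookup A y) j b

    Extents : ℕ → Table → Set
    Extents x T = ∀ j b → Extent (MarkedIn j b) x (cell T j b)

    cell-tabulate : ∀ (g : Fin J → Fin n → Cell) j b →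
                    cell (tabulate λ j → tabulate (g j)) j b ≡ g j b
    cell-tabulate g j b =
      trans (cong (λ row → lookup row b) (lookup∘tabulate _ j)) (lookup∘tabulate (g j) b)

    mark-extents : ∀ (i : Fin N) {T} → Extents (toℕ i) T →
                   Extents (suc (toℕ i)) (mark (toℕ i) (lookup A i) T)
    mark-extents i {T} E j b = subst (Extent (MarkedIn j b) _) (sym (cell-tabulate
        (λ j b → if does (marks? (toℕ i) (lookup A i) j b)
                 then extend (toℕ i) (cell T j b) else cell T j b)
        j b))
      (if-elim (Extent (MarkedIn j b) (suc (toℕ i))) (marks? (toℕ i) (lookup A i) j b)
        (λ q → extent-extend i q (E j b))
        (λ ¬q → extent-skip i ¬q (E j b)))

    -- Correctness: buckets of the window minima

    Faithful : Table → Set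
    Faithful T = ∀ {i} → i < M →
      (∀ y → InWindow K i y → β T i ≤ bkt y) × (∃[ y ] (InWindow K i y × bkt y ≡ β T i))

    hit-sound : ∀ {T} → Extents N T → ∀ {i j} → Hit T i j → ∃[ y ] (InWindow K i y × bkt y ≤ toℕ j)
    hit-sound {T} E {j = j} (b , inj₁ (i<f , f≤)) =
      let y , y≡ , _ , _ , y≤j = first (E j b) (≤-<-trans z≤n i<f)
      in y , (s≤s⁻¹ (subst (_ <_) (sym y≡) i<f) , subst (_≤ _) (sym y≡) f≤) , y≤j
    hit-sound {T} E {j = j} (b , inj₂ (i<l , l≤)) =
      let y , y≡ , _ , y≤j = last (E j b) (≤-<-trans z≤n i<l)
      in y , (s≤s⁻¹ (subst (_ <_) (sym y≡) i<l) , subst (_≤ _) (sym y≡) l≤) , y≤j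

    -- A window of length K that meets a block contains the left or the right
    -- end of the block, hence with a marked position also the first or the
    -- last marked position of the block.
    hit-complete : ∀ {T} → Extents N T → ∀ {i j} y → InWindow K i y → bkt y ≤ toℕ j → Hit T i j
    hit-complete {T} E {i} {j} y (i≤y , y<i+K) y≤j
      with b ← fromℕ< (s≤s (/-monoˡ-≤ K (<⇒≤ (toℕ<n y))))
         | b≡ ← toℕ-fromℕ< (s≤s (/-monoˡ-≤ K (<⇒≤ (toℕ<n y))))
      with 0<f , f≤ , ≤l ← covers (E j b) y (toℕ<n y) (sym b≡ , y≤j)
      with toℕ b * K <? i
    ... | no bK≮i =
      let y₁ , y₁≡ , _ , y₁∈b , _ = first (E j b) 0<f
      in b , inj₁
        ( subst (i <_) y₁≡ (s≤s (≤-trans (≮⇒≥ bK≮i)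
            (subst (λ b → b * K ≤ toℕ y₁) y₁∈b (m/n*n≤m (toℕ y₁) K))))
        , ≤-trans f≤ y<i+K )
    ... | yes bK<i =
      let y₂ , y₂≡ , y₂∈b , _ = last (E j b) (<-≤-trans z<s ≤l)
      in b , inj₂
        ( <-≤-trans (s≤s i≤y) ≤l
        , (begin
            _                                       ≡⟨ y₂≡ ⟨
            suc (toℕ y₂)                            ≡⟨ cong suc (m≡m%n+[m/n]*n (toℕ y₂) K) ⟩
            suc (toℕ y₂ % K) + (toℕ y₂ / K) * K     ≤⟨ +-monoˡ-≤ _ (m%n<n (toℕ y₂) K) ⟩
            K + (toℕ y₂ / K) * K                    ≡⟨ cong (λ b → K + b * K) y₂∈b ⟩
            K + toℕ b * K                           ≤⟨ +-monoʳ-≤ K (<⇒≤ bK<i) ⟩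
            K + i                                   ≡⟨ +-comm K i ⟩
            i + K                                   ∎))
      where open ≤-Reasoning

    extents⇒faithful : ∀ {T} → Extents N T → Faithful T
    extents⇒faithful {T} E {i} i<M = lower , attained
      where
      lower : ∀ y → InWindow K i y → β T i ≤ bkt y
      lower y y∈ with bkt y <? J
      -- The table has no row for the top bucket; there the general bound on `β` suffices.
      ... | no  y≥J = ≤-trans (β-bound T i) (≮⇒≥ y≥J)
      ... | yes y<J = subst (β T i ≤_) (toℕ-fromℕ< y<J) (β-≤ T i
        (hit-complete {T} E y y∈ (≤-reflexive (sym (toℕ-fromℕ< y<J)))))

      attained : ∃[ y ] (InWindow K i y × bkt y ≡ β T i)
      attained with β T i <? J
      ... | yes β<J =
        let j , j≡β , h = β-attained T i β<J
            y , y∈ , y≤j = hit-sound {T} E h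
        in y , y∈ , ≤-antisym (subst (bkt y ≤_) j≡β y≤j) (lower y y∈)
      -- Now `β` is the bucket of `R`, the largest one, so every position of the window attains it.
      ... | no β≥J =
        let y , y∈ = window-inhabited (>-nonZero⁻¹ K) K≤N i<M
        in y , y∈ , ≤-antisym
             (≤-trans (/-monoˡ-≤ B (toℕ≤pred[n] (lookup A y))) (≮⇒≥ β≥J)) (lower y y∈)

    -- Correctness: slots and answers in the second pass

    same-value : ∀ {u v : Value R} → bucket u ≡ bucket v → offset u ≡ offset v → u ≡ v
    same-value {u} {v} bucket≡ offset≡ = toℕ-injective (begin
      toℕ u                              ≡⟨ m≡m%n+[m/n]*n (toℕ u) B ⟩
      toℕ u % B + bucket u * B           ≡⟨ cong₂ (λ r c → r + c * B) %≡ bucket≡ ⟩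
      toℕ v % B + bucket v * B           ≡⟨ m≡m%n+[m/n]*n (toℕ v) B ⟨
      toℕ v                              ∎)
      where
      open ≡-Reasoning
      %≡ : toℕ u % B ≡ toℕ v % B
      %≡ = trans (sym (toℕ-fromℕ< _)) (trans (cong toℕ offset≡) (toℕ-fromℕ< _))

    stamp : Slots → Value R → ℕ
    stamp ts v = toℕ (lookup ts (offset v))

    -- Only stamps above `i` must be genuine, so outdated ones may stay in the slots. For a value of
    -- bucket `c` the two halves together make such a stamp that of its last position read.
    Latest : ℕ → ℕ → ℕ → Slots → Set
    Latest c i x ts =
      (∀ v → bucket v ≡ c → i < stamp ts v →
        ∃[ y ] (suc (toℕ y) ≡ stamp ts v × toℕ y < x × lookup A y ≡ v)) ×
      (∀ y → i ≤ toℕ y → toℕ y < x → bkt y ≡ c → toℕ y < stamp ts (lookup A y))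

    -- A larger bucket at `k` would have made window `e` ready, and `y` also lies in the still
    -- incomplete window `e`, which bounds `β T e` by `β T k`. Hence emptying the slots on a change
    -- of bucket loses no position that still matters.
    bucket-stable : ∀ {T} → Faithful T → ∀ {x e k} → ¬ Ready T x e → e ≤ k → k < M →
                    ∀ y → k ≤ toℕ y → toℕ y < x → bkt y ≡ β T k → β T k ≡ β T e
    bucket-stable {T} faithful {x} {e} {k} ¬ready e≤k k<M y k≤y y<x y≡ = ≤-antisym
      βk≤βe
      (subst (β T e ≤_) y≡ (proj₁ (faithful (≤-<-trans e≤k k<M)) y
        (≤-trans e≤k k≤y , <-trans y<x (≰⇒> (¬ready ∘ inj₁)))))
      where
      βk≤βe : β T k ≤ β T e
      βk≤βe with m≤n⇒m<n∨m≡n e≤k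
      ... | inj₁ e<k = ≮⇒≥ λ β< →
        ¬ready (inj₂ (k , k<M , e<k , ≤-trans k≤y (<⇒≤ y<x) , β<))
      ... | inj₂ refl = ≤-refl

    -- Earlier positions are carried over if the bucket stays and are absent by `bucket-stable` if
    -- it changes; the new item is stamped separately. Non-readiness refers to the time before this
    -- item.
    refresh-latest :
      ∀ {T} → Faithful T → ∀ (i : Fin N) {e k ts} → ¬ Ready T (toℕ i) e → e ≤ k → k < M →
      Latest (β T e) e (toℕ i) ts →
      Latest (β T k) k (suc (toℕ i)) (refresh T (toℕ i) (lookup A i) e ts k)
    refresh-latest {T} faithful i {e} {k} {ts} ¬ready e≤k k<M (sound , complete) =
      sound′ , complete′
      where
      x  = toℕ i
      u  = lookup A i
      ts′ = refresh T x u e ts k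

      x+1≡ : toℕ (word (suc x)) ≡ suc x
      x+1≡ = toℕ-word (toℕ<n i)

      new? : ∀ v → Dec (bucket u ≡ β T k × offset v ≡ offset u)
      new? v = (bucket u ≟ β T k) ×-dec (offset v Fin.≟ offset u)

      refresh-elim : ∀ v (Q : Word → Set) →
        (bucket u ≡ β T k × offset v ≡ offset u → Q (word (suc x))) →
        (¬ (bucket u ≡ β T k × offset v ≡ offset u) → β T k ≡ β T e → Q (lookup ts (offset v))) →
        (¬ (bucket u ≡ β T k × offset v ≡ offset u) → ¬ β T k ≡ β T e → Q (word 0)) →
        Q (lookup ts′ (offset v))
      refresh-elim v Q new old none = subst Q (sym (lookup∘tabulate _ (offset v)))
        (if-elim Q (new? v) new λ ¬new → if-elim Q (β T k ≟ β T e) (old ¬new) (none ¬new))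

      sound′ : ∀ v → bucket v ≡ β T k → k < stamp ts′ v → _
      sound′ v v≡ = refresh-elim v
        (λ t → k < toℕ t → ∃[ y ] (suc (toℕ y) ≡ toℕ t × toℕ y < suc x × lookup A y ≡ v))
        (λ (u≡ , v≡u) _ → i , sym x+1≡ , ≤-refl , same-value (trans u≡ (sym v≡)) (sym v≡u))
        (λ _ β≡ k<t → let y , y≡ , y<x , Ay≡ = sound v (trans v≡ β≡) (≤-<-trans e≤k k<t)
                      in y , y≡ , m<n⇒m<1+n y<x , Ay≡)
        (λ _ _ k<0 → contradiction (subst (k <_) (toℕ-word z≤n) k<0) λ ())

      complete′ : ∀ y → k ≤ toℕ y → toℕ y < suc x → bkt y ≡ β T k → toℕ y < stamp ts′ (lookup A y)
      complete′ y k≤y y≤x y≡ = refresh-elim (lookup A y) (λ t → toℕ y < toℕ t)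
        (λ _ → subst (toℕ y <_) (sym x+1≡) y≤x)
        (λ ¬new β≡ → complete y (≤-trans e≤k k≤y) (y<x ¬new) (trans y≡ β≡))
        (λ ¬new β≢ → contradiction
          (bucket-stable faithful ¬ready e≤k k<M y k≤y (y<x ¬new) y≡) β≢)
        where
        y<x : ¬ (bucket u ≡ β T k × offset (lookup A y) ≡ offset u) → toℕ y < x
        y<x ¬new = ≤∧≢⇒< (s≤s⁻¹ y≤x) λ y≡x → let y≡i = toℕ-injective y≡x in
          ¬new (subst (λ z → bkt z ≡ β T k) y≡i y≡ , cong (offset ∘ lookup A) y≡i)

    -- Readiness means that all positions of the window in its minimal bucket have been read, and
    -- `x ≤ k + K` keeps every candidate inside the window.
    answer-correct : ∀ {T} → Faithful T → ∀ {x k ts} → k < M → x ≤ k + K → Ready T x k →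
                     Latest (β T k) k x ts → IsWindowMin K A k (answer T ts k)
    answer-correct {T} faithful {x} {k} {ts} k<M x≤k+K ready (sound , complete) =
      attained , minimal
      where
      seen : Ready T x k → ∀ y → InWindow K k y → bkt y ≡ β T k → toℕ y < x
      seen (inj₁ k+K≤x) y (_ , y<k+K) y≡ = <-≤-trans y<k+K k+K≤x
      -- From `k′` on, window `k` lies inside window `k′`, whose buckets all exceed `β T k`.
      seen (inj₂ (k′ , k′<M , k<k′ , k′≤x , β<)) y (_ , y<k+K) y≡ = <-≤-trans (≰⇒> λ k′≤y →
        <⇒≱ β< (subst (β T k′ ≤_) y≡ (proj₁ (faithful k′<M) y
          (k′≤y , <-≤-trans y<k+K (+-monoˡ-≤ K (<⇒≤ k<k′)))))) k′≤x

      candidate : ∀ y → InWindow K k y → bkt y ≡ β T k → Candidate T ts k (lookup A y)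
      candidate y y∈@(k≤y , _) y≡ = y≡ , ≤-<-trans k≤y (complete y k≤y (seen ready y y∈ y≡) y≡)

      v : Value R
      v = answer T ts k

      v-candidate : Candidate T ts k v
      v-candidate with y , y∈ , y≡ ← proj₂ (faithful k<M) =
        proj₁ (answer-least T ts k (candidate y y∈ y≡))

      attained : ∃[ y ] (InWindow K k y × lookup A y ≡ v)
      attained with v≡ , k<t ← v-candidate
        with y , y≡ , y<x , Ay≡v ← sound v v≡ k<t =
        y , (s≤s⁻¹ (subst (k <_) (sym y≡) k<t) , <-≤-trans y<x x≤k+K) , Ay≡v

      minimal : ∀ j → InWindow K k j → v Fin.≤ lookup A j
      minimal j j∈ with bkt j ≟ β T k
      ... | yes j≡ = proj₂ (answer-least T ts k (candidate j j∈ j≡))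
      ... | no  j≢ = ≮⇒≥ λ Aj<v → j≢ (≤-antisym
        (subst (bkt j ≤_) (proj₁ v-candidate) (/-monoˡ-≤ B (<⇒≤ Aj<v)))
        (proj₁ (faithful k<M) j j∈))

    -- Correctness: invariants of the two passes

    Answers : ℕ → List (Value R) → Set
    Answers e os = Pointwise (IsWindowMin K A) (upTo e) os

    -- In the induction `e` stays fixed while `i` moves up. The last conjunct supplies the
    -- non-readiness on which the next item relies.
    emit-correct :
      ∀ {T x ts e} →
      (∀ {i} → e ≤ i → i < M → Ready T x i → IsWindowMin K A i (answer T (ts i) i)) →
      ∀ k {i os} → i + k ≡ M → e ≤ i → Answers i os →
      let out , e′ = emit T x ts k i in
      Answers e′ (os ++ out) × e ≤ e′ × e′ ≤ M × (e′ < M → ¬ Ready T x e′)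
    emit-correct correct zero {i} {os} i+0≡M e≤i as =
      subst (Answers i) (sym (++-identityʳ os)) as , e≤i , ≤-reflexive i≡M ,
      λ i<M → contradiction i≡M (<⇒≢ i<M)
      where i≡M = trans (sym (+-identityʳ i)) i+0≡M
    emit-correct {T} {x} {ts} {e} correct (suc k) {i} {os} i+k≡M e≤i as =
      if-elim {A = List (Value R) × ℕ}
      (λ (out , e′) → Answers e′ (os ++ out) × e ≤ e′ × e′ ≤ M × (e′ < M → ¬ Ready T x e′))
      (ready? T x i)
      (λ ready →
        let a = answer T (ts i) i
            out , e′ = emit T x ts k (suc i)
            as′ , rest = emit-correct correct k (trans (sym (+-suc i k)) i+k≡M) (m≤n⇒m≤1+n e≤i)
              (subst (λ is → Pointwise (IsWindowMin K A) is (os ++ [ a ])) (upTo-∷ʳ i)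
                (++⁺ as (correct e≤i i<M ready ∷ [])))
        in subst (Answers e′) (++-assoc os [ a ] out) as′ , rest)
      (λ ¬ready → subst (Answers i) (sym (++-identityʳ os)) as , e≤i , <⇒≤ i<M , λ _ → ¬ready)
      where
      i<M : i < M
      i<M = subst (i <_) i+k≡M (m<m+n i z<s)

    Scanned : ℕ → State → List (Value R) → Set
    Scanned x (x̂ , _ , T , _) os = os ≡ [] × toℕ x̂ ≡ x × Extents x T

    scan-invariant : ∀ (i : Fin N) {σ os} → Scanned (toℕ i) σ os →
                     Scanned (suc (toℕ i)) (scan σ (lookup A i)) (os ++ [])
    scan-invariant i {x̂ , _ , T , _} (refl , x̂≡ , E) =
      refl , trans (toℕ-word (subst (_< N) (sym x̂≡) (toℕ<n i))) (cong suc x̂≡) ,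
      subst (λ x → Extents (suc (toℕ i)) (mark x (lookup A i) T)) (sym x̂≡) (mark-extents i {T} E)

    -- The last clause is guarded because after the final answer no window is pending.
    Replied : ℕ → State → List (Value R) → Set
    Replied x (x̂ , ê , T , ts) os =
      toℕ x̂ ≡ x × Faithful T × toℕ ê ≤ M × Answers (toℕ ê) os ×
      (toℕ ê < M → ¬ Ready T x (toℕ ê) × Latest (β T (toℕ ê)) (toℕ ê) x ts)

    reply-invariant : ∀ (i : Fin N) {σ os} → Replied (toℕ i) σ os →
                      let out , σ′ = reply σ (lookup A i) in Replied (suc (toℕ i)) σ′ (os ++ out)
    reply-invariant i {x̂ , ê , T , ts} {os} (x̂≡ , faithful , ê≤M , as , pending)
      rewrite x̂≡ =
      toℕ-word (toℕ<n i) , faithful , subst (_≤ M) (sym e′≡) e′≤M ,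
      subst (λ e → Answers e (os ++ out)) (sym e′≡) as′ ,
      subst (λ e → e < M → ¬ Ready T x′ e × Latest (β T e) e x′ (ts′ e′)) (sym e′≡)
        λ e′<M → ¬ready e′<M , latest e≤e′ e′<M
      where
      e   = toℕ ê
      x′  = suc (toℕ i)
      ts′ = refresh T (toℕ i) (lookup A i) e ts
      out = proj₁ (emit T x′ ts′ (M ∸ e) e)
      e′  = proj₂ (emit T x′ ts′ (M ∸ e) e)

      latest : ∀ {k} → e ≤ k → k < M → Latest (β T k) k x′ (ts′ k)
      latest e≤k k<M = let ¬ready , l = pending (≤-<-trans e≤k k<M) in
        refresh-latest faithful i {ts = ts} ¬ready e≤k k<M l

      emitted = emit-correct {T} {x′} {ts′} {e}
        (λ e≤k k<M ready → answer-correct faithful {ts = ts′ _} k<M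
          -- Window `e` was incomplete before this item, so at most `e + K` items have been read
          -- now.
          (≤-trans (≰⇒> (proj₁ (pending (≤-<-trans e≤k k<M)) ∘ inj₁)) (+-monoˡ-≤ K e≤k))
          ready (latest e≤k k<M))
        (M ∸ e) (m+[n∸m]≡n ê≤M) ≤-refl as
      as′    = proj₁ emitted
      e≤e′   = proj₁ (proj₂ emitted)
      e′≤M   = proj₁ (proj₂ (proj₂ emitted))
      ¬ready = proj₂ (proj₂ (proj₂ emitted))

      e′≡ : toℕ (word e′) ≡ e′
      e′≡ = toℕ-word (≤-trans e′≤M (windows≤N (>-nonZero⁻¹ K) K≤N))

    rewind-replied : ∀ {T} → Faithful T → Replied 0 (rewind T) []
    rewind-replied {T} faithful rewrite toℕ-word {0} z≤n =
      refl , faithful , z≤n , [] , λ _ → ¬ready ,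
      (λ v _ 0<t → contradiction (subst (0 <_) (stamp≡0 v) 0<t) λ ()) , λ y _ ()
      where
      stamp≡0 : ∀ v → stamp (replicate B (word 0)) v ≡ 0
      stamp≡0 v = trans (cong toℕ (lookup-replicate (offset v) (word 0))) (toℕ-word z≤n)

      ¬ready : ¬ Ready T 0 0
      ¬ready (inj₁ K≤0) = <⇒≱ (>-nonZero⁻¹ K) K≤0
      ¬ready (inj₂ (_ , _ , 0<k , k≤0 , _)) = <⇒≱ 0<k k≤0

    start-scanned : Scanned 0 (rewind (replicate J (replicate n (word 0 , word 0)))) []
    start-scanned = refl , toℕ-word z≤n , λ j b →
      subst (Extent _ 0)
        (sym (trans (cong (λ row → lookup row b) (lookup-replicate j _)) (lookup-replicate b _)))
        (extent-empty (toℕ-word z≤n) (toℕ-word z≤n))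

    -- At the end of the input every window is complete and hence ready, so none can be pending.
    replied-all : ∀ {σ os} → Replied N σ os → Answers M os
    replied-all {_ , ê , T , _} {os} (_ , _ , ê≤M , as , pending) = subst (λ e → Answers e os)
      (≤-antisym ê≤M (≮⇒≥ λ ê<M → proj₁ (pending ê<M) (inj₁ (window-end ê<M)))) as

    algorithm-correct : Answers M (output algorithm (toList A))
    algorithm-correct =
      let m , os , replied , output≡ = twoPass-invariant algorithm A
            (λ x m os → Scanned x (decode stateᶜ m) os)
            (λ x m os → Replied x (decode stateᶜ m) os)
            (subst (λ σ → Scanned 0 σ []) (sym (decode∘encode stateᶜ _)) start-scanned)
            (λ i {m} {os} inv → subst (λ σ → Scanned (suc (toℕ i)) σ (os ++ []))
              (sym (decode∘encode stateᶜ _)) (scan-invariant i {decode stateᶜ m} inv))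
            (λ {m} {os} inv → subst₂ (Replied 0)
              (sym (decode∘encode stateᶜ _)) (sym (trans (++-identityʳ os) (proj₁ inv)))
              (rewind-replied (extents⇒faithful (proj₂ (proj₂ inv)))))
            (λ i {m} {os} inv → let out , σ = reply (decode stateᶜ m) (lookup A i) in
              subst (λ σ → Replied (suc (toℕ i)) σ (os ++ out))
                (sym (decode∘encode stateᶜ σ)) (reply-invariant i {decode stateᶜ m} inv))
      in subst (Answers M) (sym (trans output≡ (++-identityʳ os)))
           (replied-all {decode stateᶜ m} replied)

-- Solutions without memory for degenerate parameters

runPass-silent :
  ∀ {p R s} (alg : Algorithm p R s) (q : Fin p) → let open Algorithm alg in
  (∀ m v → proj₁ (onItem q m v) ≡ []) → ∀ xs {m} → ∃[ m′ ] runPass alg q m xs ≡ onEnd q m′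
runPass-silent alg q silent []       {m} = m , refl
runPass-silent alg q silent (x ∷ xs) {m}
  with m′ , eq ← runPass-silent alg q silent xs {proj₂ (Algorithm.onItem alg q m x)}
  rewrite silent m x = m′ , eq

-- SpaceBound forces s = 0 if R = 0, and also if N = R = 1.
constant : ℕ → Algorithm 2 0 0
constant M = record
  { start  = []
  ; onItem = λ _ m _ → [] , m
  ; onEnd  = λ { zero m → List.replicate M zero , m ; (suc _) m → [] , m }
  }

-- The function `f` is arbitrary because `applyUpTo` recurses on `f ∘ suc`.
pointwise-replicate : ∀ {A : Set} {P : ℕ → A → Set} {v} (f : ℕ → ℕ) m →
                      (∀ {i} → i < m → P (f i) v) →
                      Pointwise P (List.applyUpTo f m) (List.replicate m v)
pointwise-replicate f zero    p = []
pointwise-replicate f (suc m) p = p z<s ∷ pointwise-replicate (f ∘ suc) m (p ∘ s<s)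

constant-correct : ∀ {N K} → 1 ≤ K → K ≤ N → SolvesSlidingMin N K (constant (suc (N ∸ K)))
constant-correct {N} {K} 1≤K K≤N A
  with m₁ , eq₁ ← runPass-silent (constant (suc (N ∸ K))) zero (λ _ _ → refl) (toList A) {[]}
  with m₂ , eq₂ ← runPass-silent (constant (suc (N ∸ K))) (suc zero) (λ _ _ → refl) (toList A) {m₁}
  rewrite eq₁ | eq₂ = subst (Pointwise (IsWindowMin K A) _) (sym (++-identityʳ _))
  (pointwise-replicate (λ i → i) (suc (N ∸ K)) λ i<M →
    let y , y∈ = window-inhabited 1≤K K≤N i<M
    in (y , y∈ , zero-unique (lookup A y)) , λ _ _ → z≤n)
  where
  zero-unique : (v : Value 0) → v ≡ zero
  zero-unique zero = refl

copying : ∀ R → Algorithm 2 R 0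
copying R = record
  { start  = []
  ; onItem = λ { zero m v → [ v ] , m ; (suc _) m _ → [] , m }
  ; onEnd  = λ _ m → [] , m
  }

copying-correct : ∀ {R} → SolvesSlidingMin 1 1 (copying R)
copying-correct (v ∷ []) =
  ((zero , (z≤n , z<s) , refl) , λ { zero _ → ≤-refl }) ∷ []

-- Arithmetic of the space bound

n<2^[1+⌊log₂n⌋] : ∀ n → n < 2 ^ suc ⌊log₂ n ⌋
n<2^[1+⌊log₂n⌋] n = ≰⇒> λ 2^≤n → <⇒≱ (n<1+n ⌊log₂ n ⌋)
  (subst (_≤ ⌊log₂ n ⌋) (⌊log₂[2^n]⌋≡n (suc ⌊log₂ n ⌋)) (⌊log₂⌋-mono-≤ 2^≤n))

-- The two sides differ by the square of the difference of `a` and `b`, which is `d * d`.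
square-+-≤ : ∀ a b → (a + b) * (a + b) ≤ 2 * (a * a) + 2 * (b * b)
square-+-≤ a b with ≤-total a b
... | inj₁ a≤b with d , refl ← m≤n⇒∃[o]m+o≡n a≤b =
  subst ((a + (a + d)) * (a + (a + d)) ≤_) (identity a d) (m≤m+n _ (d * d))
  where
  identity : ∀ a d → (a + (a + d)) * (a + (a + d)) + d * d ≡ 2 * (a * a) + 2 * ((a + d) * (a + d))
  identity = solve-∀
... | inj₂ b≤a with d , refl ← m≤n⇒∃[o]m+o≡n b≤a =
  subst ((b + d + b) * (b + d + b) ≤_) (identity b d) (m≤m+n _ (d * d))
  where
  identity : ∀ b d → (b + d + b) * (b + d + b) + d * d ≡ 2 * ((b + d) * (b + d)) + 2 * (b * b)
  identity = solve-∀

-- `B` is the square root of `X / K` rounded up, found by descending from `suc X`. If `B ≥ 2`, then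
-- `B - 1` is too small and `B ≤ 2 * (B - 1)`; if `B = 1`, the upper bound follows from `K ≤ X`.
scaled-sqrt : ∀ K X .{{_ : NonZero K}} → K ≤ X →
              ∃[ B ] (NonZero B × X ≤ K * (B * B) × K * (B * B) ≤ 4 * X)
scaled-sqrt K X K≤X = descend X
  (≤-trans (n≤1+n X) (≤-trans (m≤m*n (suc X) (suc X)) (m≤n*m (suc X * suc X) K)))
  where
  descend : ∀ b → X ≤ K * (suc b * suc b) →
            ∃[ B ] (NonZero B × X ≤ K * (B * B) × K * (B * B) ≤ 4 * X)
  descend zero X≤ = 1 , _ , X≤ ,
    ≤-trans (≤-reflexive (*-identityʳ K)) (≤-trans K≤X (m≤n*m X 4))
  descend (suc b′) X≤ with X ≤? K * (suc b′ * suc b′)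
  ... | yes X≤′ = descend b′ X≤′
  ... | no  X≰  = suc b , _ , X≤ , (begin
    K * (suc b * suc b)       ≤⟨ *-monoʳ-≤ K (*-mono-≤ 1+b≤2b 1+b≤2b) ⟩
    K * ((b + b) * (b + b))   ≡⟨ identity K b ⟩
    4 * (K * (b * b))         ≤⟨ *-monoʳ-≤ 4 (<⇒≤ (≰⇒> X≰)) ⟩
    4 * X                     ∎)
    where
    b = suc b′
    open ≤-Reasoning
    1+b≤2b : suc b ≤ b + b
    1+b≤2b = +-monoˡ-≤ b (s≤s z≤n)
    identity : ∀ K b → K * ((b + b) * (b + b)) ≡ 4 * (K * (b * b))
    identity = solve-∀

-- The number of cells is at most `2NR / (KB)`, and `B` is at least the square root of `NR / K`.
-- Multiplying by `K * (B * B)` and cancelling avoids the divisions.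
table-size : ∀ {N K R B J n} .{{_ : NonZero K}} .{{_ : NonZero B}} →
             J * B ≤ R → n * K ≤ 2 * N → N * R ≤ K * (B * B) →
             K * ((J * n) * (J * n)) ≤ 4 * (N * R)
table-size {N} {K} {R} {B} {J} {n} JB≤R nK≤2N NR≤ =
  *-cancelʳ-≤ _ _ (K * (B * B)) {{m*n≢0 K (B * B)}} (begin
    K * ((J * n) * (J * n)) * (K * (B * B))       ≡⟨ identity₁ K J n B ⟩
    (J * B) * (n * K) * ((J * B) * (n * K))       ≤⟨ *-mono-≤ ≤2NR ≤2NR ⟩
    R * (2 * N) * (R * (2 * N))                   ≡⟨ identity₂ N R ⟩
    4 * (N * R) * (N * R)                         ≤⟨ *-monoʳ-≤ (4 * (N * R)) NR≤ ⟩
    4 * (N * R) * (K * (B * B))                   ∎)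
  where
  open ≤-Reasoning
  instance
    B*B≢0 : NonZero (B * B)
    B*B≢0 = m*n≢0 B B
  ≤2NR = *-mono-≤ JB≤R nK≤2N
  identity₁ : ∀ K J n B → K * ((J * n) * (J * n)) * (K * (B * B)) ≡
                          (J * B) * (n * K) * ((J * B) * (n * K))
  identity₁ = solve-∀
  identity₂ : ∀ N R → R * (2 * N) * (R * (2 * N)) ≡ 4 * (N * R) * (N * R)
  identity₂ = solve-∀

-- The squared factor counts the words of a state: two counters, two stamps in each of `u` cells,
-- and `B` slots.
words-bound : ∀ {K X u B} → K ≤ X → K * (u * u) ≤ 4 * X → K * (B * B) ≤ 4 * X →
              K * ((2 + 2 * u + B) * (2 + 2 * u + B)) ≤ 100 * X
words-bound {K} {X} {u} {B} K≤X u≤ B≤ = begin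
  K * ((2 + 2 * u + B) * (2 + 2 * u + B))
    ≤⟨ *-monoʳ-≤ K (square-+-≤ (2 + 2 * u) B) ⟩
  K * (2 * ((2 + 2 * u) * (2 + 2 * u)) + 2 * (B * B))
    ≤⟨ *-monoʳ-≤ K (+-monoˡ-≤ (2 * (B * B)) (*-monoʳ-≤ 2 (square-+-≤ 2 (2 * u)))) ⟩
  K * (2 * (8 + 2 * ((2 * u) * (2 * u))) + 2 * (B * B))
    ≡⟨ identity₁ K u B ⟩
  16 * K + 16 * (K * (u * u)) + 2 * (K * (B * B))
    ≤⟨ +-mono-≤ (+-mono-≤ (*-monoʳ-≤ 16 K≤X) (*-monoʳ-≤ 16 u≤)) (*-monoʳ-≤ 2 B≤) ⟩
  16 * X + 16 * (4 * X) + 2 * (4 * X)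
    ≡⟨ identity₂ X ⟩
  88 * X
    -- Rounding up to the square of 10, which with word length at most `2 * L` gives the constant
    -- 20.
    ≤⟨ *-monoˡ-≤ X (m≤m+n 88 12) ⟩
  100 * X ∎
  where
  open ≤-Reasoning
  identity₁ : ∀ K u B → K * (2 * (8 + 2 * ((2 * u) * (2 * u))) + 2 * (B * B)) ≡
                        16 * K + 16 * (K * (u * u)) + 2 * (K * (B * B))
  identity₁ = solve-∀
  identity₂ : ∀ X → 16 * X + 16 * (4 * X) + 2 * (4 * X) ≡ 88 * X
  identity₂ = solve-∀

space-bound : ∀ {N K R B w} .{{_ : NonZero K}} .{{_ : NonZero B}} → K ≤ N → 1 ≤ R →
              N * R ≤ K * (B * B) → K * (B * B) ≤ 4 * (N * R) →
              w ≤ 2 * (⌊log₂ R ⌋ + ⌊log₂ N ⌋) →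
              SpaceBound 20 N K R
                (w + (w + ((R / B) * (suc (N / K) * (w + w)) + B * w)))
space-bound {N} {K} {R} {B} {w} K≤N 1≤R NR≤ ≤4NR w≤ = begin
  K * (w + (w + (J * (n * (w + w)) + B * w))) ^ 2
    ≡⟨ identity₁ K J n B w ⟩
  K * ((2 + 2 * (J * n) + B) * (2 + 2 * (J * n) + B)) * (w * w)
    ≤⟨ *-mono-≤ (words-bound {K} {N * R} {J * n} {B} K≤NR table≤ ≤4NR) (*-mono-≤ w≤ w≤) ⟩
  100 * (N * R) * ((2 * L) * (2 * L))
    ≡⟨ identity₂ (N * R) L ⟩
  N * R * (20 * L) ^ 2 ∎
  where
  open ≤-Reasoning
  J = R / B
  n = suc (N / K)
  L = ⌊log₂ R ⌋ + ⌊log₂ N ⌋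
  JB≤R : J * B ≤ R
  JB≤R = m/n*n≤m R B
  nK≤2N : n * K ≤ 2 * N
  -- The extra block contributes `K`, which is at most `N`.
  nK≤2N = +-mono-≤ K≤N (≤-trans (m/n*n≤m N K) (m≤m+n N 0))
  table≤ : K * ((J * n) * (J * n)) ≤ 4 * (N * R)
  table≤ = table-size {N} {K} {R} {B} {J} {n} JB≤R nK≤2N NR≤
  K≤NR : K ≤ N * R
  K≤NR = ≤-trans K≤N (m≤m*n N R {{>-nonZero 1≤R}})
  identity₁ : ∀ K J n B w → let s = w + (w + (J * (n * (w + w)) + B * w)) in K * (s * (s * 1)) ≡
                K * ((2 + 2 * (J * n) + B) * (2 + 2 * (J * n) + B)) * (w * w)
  identity₁ = solve-∀
  identity₂ : ∀ X L → 100 * X * ((2 * L) * (2 * L)) ≡ X * (20 * L * (20 * L * 1))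
  identity₂ = solve-∀

spaceBound-zero : ∀ C N K R → SpaceBound C N K R 0
spaceBound-zero C N K R = ≤-trans (≤-reflexive (*-zeroʳ K)) z≤n

proposition3p3 : Σ[ C ∈ ℕ ] (∀ (N K R : ℕ) → 1 ≤ K → K ≤ N →
    Σ[ s ∈ ℕ ] (SpaceBound C N K R s ×
    (Σ[ alg ∈ Algorithm 2 R s ] SolvesSlidingMin N K alg)))
proposition3p3 = 20 , solution
  where
  solution : ∀ N K R → 1 ≤ K → K ≤ N →
    Σ[ s ∈ ℕ ] (SpaceBound 20 N K R s × (Σ[ alg ∈ Algorithm 2 R s ] SolvesSlidingMin N K alg))
  solution N K zero 1≤K K≤N =
    0 , spaceBound-zero 20 N K 0 , constant _ , constant-correct 1≤K K≤N
  solution 1 1 R _ _ = 0 , spaceBound-zero 20 1 1 R , copying R , copying-correct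
  solution 1 (suc (suc _)) (suc _) _ (s≤s ())
  solution N@(suc (suc _)) K@(suc _) R@(suc _) _ K≤N
    with B , B≢0 , NR≤ , ≤4NR ← scaled-sqrt K (N * R) (≤-trans K≤N (m≤m*n N R)) =
    _ , space-bound {{_}} {{B≢0}} K≤N z<s NR≤ ≤4NR w≤ ,
    TwoPass.algorithm N K R B w {{_}} {{B≢0}} ,
    TwoPass.Correctness.algorithm-correct N K R B w {{_}} {{B≢0}} (n<2^[1+⌊log₂n⌋] N) K≤N
    where
    w = suc ⌊log₂ N ⌋
    -- Here `N` is at least 2, so the logarithm absorbs the `suc` in the word length.
    1≤log : 1 ≤ ⌊log₂ N ⌋
    1≤log = ⌊log₂⌋-mono-≤ {2} {N} (s≤s (s≤s z≤n))
    w≤ : w ≤ 2 * (⌊log₂ R ⌋ + ⌊log₂ N ⌋)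
    w≤ = ≤-trans (+-monoˡ-≤ ⌊log₂ N ⌋ 1≤log)
      (+-mono-≤ (m≤n+m ⌊log₂ N ⌋ ⌊log₂ R ⌋) (≤-trans (m≤n+m ⌊log₂ N ⌋ ⌊log₂ R ⌋) (m≤m+n _ 0)))
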